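{- Let $t\ge 1$ and let $S_{t+1}^{\circ}$ be the fully looped star on $t+1$ vertices $v_0,v_1,\ldots,v_t$, with $v_0$ the center of the star. Let $\mathbf{n}=(n_0,n_1,\ldots,n_t)$ be any vector of positive integers. The blow-up of $S_{t+1}^{\circ}$ by $\mathbf{n}$ is Hoffman-London.
   Context: The fully looped star $S_{t+1}^{\circ}$ has edges $v_0v_i$ for $1\le i\le t$ and a loop at each of $v_0,\ldots,v_t$. Blow-up: let $H$ be a graph on vertex set $\{v_0,\ldots,v_k\}$ without multiple edges but perhaps with loops, and let $\mathbf{n}=(n_0,\ldots,n_k)$ be a vector of positive integers. The blow-up $H^{\mathbf{n}}$ has vertex set $\bigcup_{i=0}^k V_i$, where the $V_i$ are pairwise disjoint sets with $|V_i|=n_i$. If $v_i\sim_H v_j$ (with either $i\ne j$ or $i=j$), then there is an edge in $H^{\mathbf{n}}$ between every $x\in V_i$ and $y\in V_j$ (so if $v_i$ is looped, $V_i$ induces a complete graph with a loop at every vertex), and there are no other edges. For a target graph $H$ (no multiple edges, possibly with loops) and a simple loopless graph $G$, an $H$-coloring of $G$ is a map $f:V(G)\to V(H)$ such that $f(u)\sim_H f(v)$ whenever $u\sim_G v$; $\hom(G,H)$ denotes the number of $H$-colorings of $G$. $\mathcal{T}_n$ is the set of all trees on $n$ vertices (up to isomorphism) and $P_n\in\mathcal{T}_n$ is the path on $n$ vertices. $H$ is Hoffman-London if for all $n\ge 1$, $\hom(P_n,H)=\min_{T_n\in\mathcal{T}_n}\hom(T_n,H)$. -}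

module Defs where

open import Data.Fin using (Fin; zero; suc; toℕ; _≟_)
open import Data.Fin.Properties using (all?)
open import Data.List using (List; []; _∷_; [_]; _∷ʳ_; map; length; filter; allFin; concatMap; cartesianProductWith)
open import Data.List.Membership.Propositional using (_∈_)
open import Data.List.Membership.Propositional.Properties using (∈-allFin; ∈-map⁺; ∈-map⁻; ∈-concatMap⁺)
open import Data.List.Relation.Binary.Disjoint.Propositional using (Disjoint)
open import Data.List.Relation.Unary.All using (universal)
import Data.List.Relation.Unary.All.Properties as All
import Data.List.Relation.Unary.AllPairs as AllPairs
import Data.List.Relation.Unary.AllPairs.Properties as AllPairs
import Data.List.Relation.Unary.Any as Any
open import Data.List.Relation.Unary.Linked using (Linked)
open import Data.List.Relation.Unary.Unique.Propositional using (Unique)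
import Data.List.Relation.Unary.Unique.Propositional.Properties as Unique
open import Data.Nat using (ℕ; suc; _≤_; _≥_)
import Data.Nat as ℕ
open import Data.Nat.Properties using (1+n≢n)
open import Data.Product using (Σ-syntax; _×_; _,_)
open import Data.Product.Properties.WithK using (,-injectiveʳ)
open import Data.Sum using (_⊎_; swap; reduce)
open import Data.Vec using (Vec; lookup; []; _∷_)
open import Relation.Binary using (Rel; Decidable; Symmetric; Irreflexive)
open import Relation.Binary.Construct.Closure.ReflexiveTransitive using (Star)
open import Relation.Binary.PropositionalEquality using (_≡_; _≢_; refl; sym)
open import Relation.Nullary using (¬_; Dec; yes; no)
open import Relation.Nullary.Decidable using (_⊎-dec_; _→-dec_)
open import Level using (0ℓ)

-- Finite graphs, loops allowed, no multiple edges: only whether v ~ w holds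
-- matters, never how many proofs of it there are.
record Graph : Set₁ where
  infix 4 _~_
  field
    V        : Set
    vertices : List V
    complete : ∀ v → v ∈ vertices
    unique   : Unique vertices
    _~_      : Rel V 0ℓ
    ~-sym    : Symmetric _~_
    _~?_     : Decidable _~_

record SimpleGraph (n : ℕ) : Set₁ where
  infix 4 _~_
  field
    _~_      : Rel (Fin n) 0ℓ
    ~-sym    : Symmetric _~_
    ~-irrefl : Irreflexive _≡_ _~_
    _~?_     : Decidable _~_

module _ {n : ℕ} (G : SimpleGraph n) where
  open SimpleGraph G

  Connected : Set
  Connected = ∀ u v → Star _~_ u v

  -- The cycle v, v₁, …, vₘ, v, where vs = v₁, …, vₘ.
  IsCycle : Fin n → List (Fin n) → Set
  IsCycle v vs = length vs ≥ 2 × Unique (v ∷ vs) × Linked _~_ (v ∷ (vs ∷ʳ v))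

  Acyclic : Set
  Acyclic = ∀ v vs → ¬ IsCycle v vs

  IsTree : Set
  IsTree = Connected × Acyclic

path : ∀ n → SimpleGraph n
path n = record
  { _~_      = λ i j → toℕ j ≡ suc (toℕ i) ⊎ toℕ i ≡ suc (toℕ j)
  ; ~-sym    = swap
  ; ~-irrefl = λ { refl i~i → 1+n≢n (sym (reduce i~i)) }
  ; _~?_     = λ i j → (toℕ j ℕ.≟ suc (toℕ i)) ⊎-dec (toℕ i ℕ.≟ suc (toℕ j))
  }

module _ {n : ℕ} (G : SimpleGraph n) (H : Graph) where
  private
    module G = SimpleGraph G
    module H = Graph H

  IsColoring : (Fin n → H.V) → Set
  IsColoring f = ∀ u v → u G.~ v → f u H.~ f v

  isColoring? : (f : Fin n → H.V) → Dec (IsColoring f)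
  isColoring? f = all? λ u → all? λ v → (u G.~? v) →-dec (f u H.~? f v)

-- Every vector of length n with entries in xs, once each if xs is unique.
vectors : {A : Set} → List A → ∀ n → List (Vec A n)
vectors xs ℕ.zero = [ [] ]
vectors xs (suc n) = cartesianProductWith _∷_ xs (vectors xs n)

-- Maps V(G) → V(H) are represented by their vectors of values, so that
-- pointwise equal maps are counted once.
hom : ∀ {n} → SimpleGraph n → Graph → ℕ
hom {n} G H = length (filter (λ f → isColoring? G H (lookup f)) (vectors (Graph.vertices H) n))

IsMinimumOf : ℕ → (ℕ → Set₁) → Set₁
IsMinimumOf m S = S m × (∀ k → S k → m ≤ k)

-- Trees are taken on the labelled vertex set Fin n; this yields every
-- isomorphism class, and hom T H depends only on the class of T.
HoffmanLondon : Graph → Set₁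
HoffmanLondon H = ∀ n → n ≥ 1 →
  IsMinimumOf (hom (path n) H) λ k → Σ[ T ∈ SimpleGraph n ] (IsTree T × hom T H ≡ k)

data StarEdge {t : ℕ} : Rel (Fin (suc t)) 0ℓ where
  loop    : ∀ {i} → StarEdge i i
  outward : ∀ {i} → StarEdge zero (suc i)
  inward  : ∀ {i} → StarEdge (suc i) zero

loopedStar : ℕ → Graph
loopedStar t = record
  { V        = Fin (suc t)
  ; vertices = allFin (suc t)
  ; complete = ∈-allFin
  ; unique   = Unique.allFin⁺ (suc t)
  ; _~_      = StarEdge
  ; ~-sym    = λ { loop → loop ; outward → inward ; inward → outward }
  ; _~?_     = edge?
  }
  where
  edge? : Decidable (StarEdge {t})
  edge? zero    zero    = yes loop
  edge? zero    (suc _) = yes outward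
  edge? (suc _) zero    = yes inward
  edge? (suc i) (suc j) with i ≟ j
  ... | yes refl = yes loop
  ... | no  i≢j  = no λ { loop → i≢j refl }

blowUp : (H : Graph) → (Graph.V H → ℕ) → Graph
blowUp H n = record
  { V        = Σ[ v ∈ H.V ] Fin (n v)
  ; vertices = concatMap part H.vertices
  ; complete = λ { (v , x) → ∈-concatMap⁺ part
                   (Any.map (λ { refl → ∈-map⁺ (v ,_) (∈-allFin x) }) (H.complete v)) }
  ; unique   = Unique.concat⁺
      (All.map⁺ (universal (λ v → Unique.map⁺ ,-injectiveʳ (Unique.allFin⁺ (n v))) H.vertices))
      (AllPairs.map⁺ (AllPairs.map parts-disjoint H.unique))
  ; _~_      = λ (v , _) (w , _) → v H.~ w
  ; ~-sym    = H.~-sym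
  ; _~?_     = λ (v , _) (w , _) → v H.~? w
  }
  where
  module H = Graph H

  part : (v : H.V) → List (Σ[ v ∈ H.V ] Fin (n v))
  part v = map (v ,_) (allFin (n v))

  parts-disjoint : ∀ {v w} → v ≢ w → Disjoint (part v) (part w)
  parts-disjoint {v} {w} v≢w (p∈v , p∈w) with ∈-map⁻ (v ,_) p∈v | ∈-map⁻ (w ,_) p∈w
  ... | _ , _ , refl | _ , _ , refl = v≢w refl

{-# OPTIONS --safe #-}
module Submission where

-- Order the vertices of the blow-up H by their part: the centre on top, the leaves by
-- their size. A larger vertex has, up to domination, a larger neighbourhood, so the number
-- of colourings of a rooted tree is monotone in the colour of its root. For monotone A, B
-- and a symmetric matrix M ≥ 0, Σ M(u,v) (A u − A v) (B u − B v) ≥ 0; with M counting the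
-- walks of length k this says that gluing two trees to the two ends of a path with k edges
-- gives at most as many colourings as gluing both of them to the same end. Hence a tree
-- can be straightened, branch by branch, to a path without increasing the count.
-- The rooted trees come from pruning leaves of T, each kept as a weight at its neighbour.

open import Algebra.Bundles using (CommutativeMonoid)
import Algebra.Properties.CommutativeMonoid.Sum as CommutativeMonoidSum
open import Data.Bool using (true; false; if_then_else_)
open import Data.Fin using (Fin; zero; suc; toℕ; punchIn; punchOut)
open import Data.Fin.Properties using (any?; injective⇒≤; punchIn-injective; punchIn-punchOut; toℕ-injective)
  renaming (suc-injective to sucᶠ-injective)
import Data.Fin as Fin
open import Data.List using (List; []; _∷_; [_]; _++_; _∷ʳ_; allFin; length; map; filter; tabulate; concatMap; cartesianProductWith)
import Data.List as List
open import Data.List.Membership.Propositional.Properties using (∈-∃++; ∈-lookup)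
import Data.List.Properties as List
import Data.List.Membership.DecPropositional as DecMembership
open import Data.List.Relation.Unary.All as All using ([]; _∷_)
import Data.List.Relation.Unary.All.Properties as All
open import Data.List.Relation.Unary.AllPairs as AllPairs using ([]; _∷_)
open import Data.List.Relation.Unary.Any using (here; there)
open import Data.List.Relation.Unary.Linked as Linked using (Linked; [-]; _∷_)
import Data.List.Relation.Unary.Linked.Properties as Linked
open import Data.List.Relation.Unary.Unique.Propositional using (Unique)
import Data.List.Relation.Unary.Unique.Propositional.Properties as Unique
open import Data.Nat using (ℕ; zero; suc; _+_; _*_; _≤_; _≥_; z≤n; s≤s)
open import Data.Nat.Properties
open import Data.Nat.Tactic.RingSolver using (solve-∀)
open import Data.Product using (Σ-syntax; ∃₂; _×_; _,_; proj₁)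
open import Data.Sum using (_⊎_; inj₁; inj₂; swap)
open import Data.Vec using (Vec; []; _∷_; lookup; insertAt)
open import Data.Vec.Functional using (Vector; updateAt; removeAt)
open import Data.Vec.Properties using (insertAt-lookup; insertAt-punchIn)
open import Defs
open import Function using (_∘_; _on_; const; flip; id)
open import Level using (0ℓ)
open import Relation.Binary using (Rel; Total; Transitive)
open import Relation.Binary.Construct.Closure.ReflexiveTransitive using (Star; ε; _◅_; _◅◅_; gmap; reverse)
open import Relation.Binary.PropositionalEquality hiding ([_])
open import Relation.Nullary using (¬_; Dec; yes; no; does; contradiction)
open import Relation.Nullary.Decidable using (_×-dec_; ¬?)

private
  variable
    A B : Set
    n : ℕ

-- Finite sums

module _ {c ℓ} (M : CommutativeMonoid c ℓ) where
  open CommutativeMonoid M renaming (sym to ≈-sym; trans to ≈-trans)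
  open CommutativeMonoidSum M using () renaming (sum to ∑∙)

  -- Stated for any commutative monoid because pruning a leaf needs it twice: for the product of the
  -- weights and for the sum of the edge counts.
  sum-updateAt : ∀ {n} {T : Set} (h : Fin n → T → Carrier) (τ : Vector T n) p (f : T → T) {x} →
                 h p (f (τ p)) ≈ h p (τ p) ∙ x →
                 ∑∙ (λ i → h i (updateAt τ p f i)) ≈ ∑∙ (λ i → h i (τ i)) ∙ x
  sum-updateAt h τ zero f eq =
    ≈-trans (∙-congʳ eq) (≈-trans (assoc _ _ _) (≈-trans (∙-congˡ (comm _ _)) (≈-sym (assoc _ _ _))))
  sum-updateAt h τ (suc p) f eq =
    ≈-trans (∙-congˡ (sum-updateAt (h ∘ suc) (τ ∘ suc) p f eq)) (≈-sym (assoc _ _ _))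

open CommutativeMonoidSum +-0-commutativeMonoid using (sum; sum-cong-≗; sum-remove; sum-replicate-zero)
module Product = CommutativeMonoidSum *-1-commutativeMonoid

∏ : Vector ℕ n → ℕ
∏ = Product.sum

-- Match the `m` terms of `f` with the first `m` terms of `g`; the surplus terms of `g` are
-- nonnegative. This compares parts of different sizes.
sum-mono-size : ∀ {m n} {f : Vector ℕ m} {g : Vector ℕ n} →
                m ≤ n → (∀ i j → f i ≤ g j) → sum f ≤ sum g
sum-mono-size z≤n       f≤g = z≤n
sum-mono-size (s≤s m≤n) f≤g = +-mono-≤ (f≤g zero zero) (sum-mono-size m≤n λ i j → f≤g (suc i) (suc j))

sum-single : (f : Vector ℕ n) (i : Fin n) → (∀ j → i ≢ j → f j ≡ 0) → sum f ≡ f i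
sum-single {suc n} f zero f≡0 =
  trans (cong (f zero +_) (trans (sum-cong-≗ (λ j → f≡0 (suc j) λ ())) (sum-replicate-zero n))) (+-identityʳ _)
sum-single {suc n} f (suc i) f≡0 =
  cong₂ _+_ (f≡0 zero λ ()) (sum-single (f ∘ suc) i λ j i≢j → f≡0 (suc j) (i≢j ∘ sucᶠ-injective))

-- Sums over lists

∑ : List A → (A → ℕ) → ℕ
∑ []       f = 0
∑ (x ∷ xs) f = f x + ∑ xs f

∑-cong : ∀ (xs : List A) {f g} → (∀ x → f x ≡ g x) → ∑ xs f ≡ ∑ xs g
∑-cong []       f≗g = refl
∑-cong (x ∷ xs) f≗g = cong₂ _+_ (f≗g x) (∑-cong xs f≗g)

∑-mono : ∀ (xs : List A) {f g} → (∀ x → f x ≤ g x) → ∑ xs f ≤ ∑ xs g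
∑-mono []       f≤g = z≤n
∑-mono (x ∷ xs) f≤g = +-mono-≤ (f≤g x) (∑-mono xs f≤g)

∑-zero : ∀ (xs : List A) → ∑ xs (const 0) ≡ 0
∑-zero []       = refl
∑-zero (x ∷ xs) = ∑-zero xs

∑-+ : ∀ (xs : List A) f g → ∑ xs (λ x → f x + g x) ≡ ∑ xs f + ∑ xs g
∑-+ []       f g = refl
∑-+ (x ∷ xs) f g = trans (cong (f x + g x +_) (∑-+ xs f g)) (interchange (f x) (g x) _ _)
  where
  interchange : ∀ a b c d → a + b + (c + d) ≡ a + c + (b + d)
  interchange = solve-∀

∑-*ˡ : ∀ (xs : List A) k f → ∑ xs (λ x → k * f x) ≡ k * ∑ xs f
∑-*ˡ []       k f = sym (*-zeroʳ k)
∑-*ˡ (x ∷ xs) k f = trans (cong (k * f x +_) (∑-*ˡ xs k f)) (sym (*-distribˡ-+ k (f x) _))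

∑-swap : ∀ (xs : List A) (ys : List B) (f : A → B → ℕ) →
         ∑ xs (λ x → ∑ ys (f x)) ≡ ∑ ys (λ y → ∑ xs (λ x → f x y))
∑-swap []       ys f = sym (∑-zero ys)
∑-swap (x ∷ xs) ys f = trans (cong (∑ ys (f x) +_) (∑-swap xs ys f)) (sym (∑-+ ys (f x) _))

∑-++ : ∀ (xs ys : List A) f → ∑ (xs ++ ys) f ≡ ∑ xs f + ∑ ys f
∑-++ []       ys f = refl
∑-++ (x ∷ xs) ys f = trans (cong (f x +_) (∑-++ xs ys f)) (sym (+-assoc (f x) _ _))

∑-map : ∀ (g : A → B) xs f → ∑ (map g xs) f ≡ ∑ xs (f ∘ g)
∑-map g []       f = refl
∑-map g (x ∷ xs) f = cong (f (g x) +_) (∑-map g xs f)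

∑-concatMap : ∀ (g : A → List B) xs f → ∑ (concatMap g xs) f ≡ ∑ xs (λ x → ∑ (g x) f)
∑-concatMap g []       f = refl
∑-concatMap g (x ∷ xs) f = trans (∑-++ (g x) _ f) (cong (∑ (g x) f +_) (∑-concatMap g xs f))

∑-tabulate : ∀ (g : Fin n → A) f → ∑ (tabulate g) f ≡ sum (f ∘ g)
∑-tabulate {zero}  g f = refl
∑-tabulate {suc n} g f = cong (f (g zero) +_) (∑-tabulate (g ∘ suc) f)

∑-cartesianProductWith : ∀ {C : Set} (h : A → B → C) xs ys f →
  ∑ (cartesianProductWith h xs ys) f ≡ ∑ xs (λ x → ∑ ys (f ∘ h x))
∑-cartesianProductWith h []       ys f = refl
∑-cartesianProductWith h (x ∷ xs) ys f =
  trans (∑-++ (map (h x) ys) _ f) (cong₂ _+_ (∑-map (h x) ys f) (∑-cartesianProductWith h xs ys f))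

-- Separates the colour of the vertex `l` from the other colours: induction on `l`, exchanging the
-- sums over the head and over the inserted entry.
∑-vectors-insertAt : ∀ (xs : List A) (l : Fin (suc n)) (F : Vec A (suc n) → ℕ) →
  ∑ (vectors xs (suc n)) F ≡ ∑ xs (λ x → ∑ (vectors xs n) (λ g → F (insertAt g l x)))
∑-vectors-insertAt {n = n} xs zero F = ∑-cartesianProductWith _∷_ xs (vectors xs n) F
∑-vectors-insertAt {n = suc n} xs (suc l) F = begin
  ∑ (vectors xs (2 + n)) F
    ≡⟨ ∑-cartesianProductWith _∷_ xs (vectors xs (suc n)) F ⟩
  ∑ xs (λ y → ∑ (vectors xs (suc n)) (F ∘ (y ∷_)))
    ≡⟨ ∑-cong xs (λ y → ∑-vectors-insertAt xs l (F ∘ (y ∷_))) ⟩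
  ∑ xs (λ y → ∑ xs (λ x → ∑ (vectors xs n) (λ g → F (y ∷ insertAt g l x))))
    ≡⟨ ∑-swap xs xs (λ y x → ∑ (vectors xs n) (λ g → F (y ∷ insertAt g l x))) ⟩
  ∑ xs (λ x → ∑ xs (λ y → ∑ (vectors xs n) (λ g → F (y ∷ insertAt g l x))))
    ≡⟨ ∑-cong xs (λ x → ∑-cartesianProductWith _∷_ xs (vectors xs n) (λ g → F (insertAt g (suc l) x))) ⟨
  ∑ xs (λ x → ∑ (vectors xs (suc n)) (λ g → F (insertAt g (suc l) x))) ∎
  where open ≡-Reasoning

-- Indicators of decidable propositions

𝟙 : Dec A → ℕ
𝟙 d = if does d then 1 else 0

𝟙-yes : (d : Dec A) → A → 𝟙 d ≡ 1
𝟙-yes (yes _) _ = refl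
𝟙-yes (no ¬a) a = contradiction a ¬a

𝟙-no : (d : Dec A) → ¬ A → 𝟙 d ≡ 0
𝟙-no (yes a) ¬a = contradiction a ¬a
𝟙-no (no _)  _  = refl

𝟙≤1 : (d : Dec A) → 𝟙 d ≤ 1
𝟙≤1 (yes _) = ≤-refl
𝟙≤1 (no _)  = z≤n

𝟙-mono : (d : Dec A) (e : Dec B) → (A → B) → 𝟙 d ≤ 𝟙 e
𝟙-mono (yes a) e f = ≤-reflexive (sym (𝟙-yes e (f a)))
𝟙-mono (no _)  e f = z≤n

𝟙-× : (d : Dec A) (e : Dec B) → 𝟙 (d ×-dec e) ≡ 𝟙 d * 𝟙 e
𝟙-× (yes _) e = sym (+-identityʳ _)
𝟙-× (no _)  e = refl

length-filter : ∀ {P : A → Set} (P? : ∀ x → Dec (P x)) xs → length (filter P? xs) ≡ ∑ xs (𝟙 ∘ P?)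
length-filter P? [] = refl
length-filter P? (x ∷ xs) with does (P? x)
... | true  = cong suc (length-filter P? xs)
... | false = length-filter P? xs

-- Acyclic graphs

unique-++⁻ˡ : ∀ xs {ys : List A} → Unique (xs ++ ys) → Unique xs
unique-++⁻ˡ []       _          = []
unique-++⁻ˡ (x ∷ xs) (x∉ ∷ u) = All.++⁻ˡ xs x∉ ∷ unique-++⁻ˡ xs u

unique-lookup-injective : ∀ {xs : List A} → Unique xs →
                          ∀ i j → List.lookup xs i ≡ List.lookup xs j → i ≡ j
unique-lookup-injective {xs = _ ∷ _} u        zero    zero    eq = refl
unique-lookup-injective {xs = _ ∷ _} (x∉ ∷ u) zero    (suc j) eq = contradiction eq (All.lookup x∉ (∈-lookup j))
unique-lookup-injective {xs = _ ∷ _} (x∉ ∷ u) (suc i) zero    eq = contradiction (sym eq) (All.lookup x∉ (∈-lookup i))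
unique-lookup-injective {xs = _ ∷ _} (x∉ ∷ u) (suc i) (suc j) eq = cong suc (unique-lookup-injective u i j eq)

unique⇒length≤ : {xs : List (Fin n)} → Unique xs → length xs ≤ n
unique⇒length≤ u = injective⇒≤ λ {i} {j} → unique-lookup-injective u i j

linked-close : ∀ {R : Rel A 0ℓ} {x w z} ys {zs} →
               Linked R (x ∷ ys ++ w ∷ zs) → R w z → Linked R (x ∷ (ys ∷ʳ w) ∷ʳ z)
linked-close []       (r ∷ _)  w~z = r ∷ w~z ∷ [-]
linked-close (y ∷ ys) (r ∷ rs) w~z = r ∷ linked-close ys rs w~z

module _ (G : SimpleGraph n) where
  open SimpleGraph G

  -- Vacuously true of an isolated `l`, so pruning also applies to forests, which may arise without
  -- tracking connectedness.
  HasOnlyNeighbour : Fin n → Fin n → Set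
  HasOnlyNeighbour l p = ∀ w → l ~ w → w ≡ p

  module _ (acyclic : Acyclic G) where

    -- k bounds the number of remaining extensions: it counts the vertices off the path.
    extend-to-leaf : ∀ k a b ps → length (a ∷ b ∷ ps) + k ≡ n →
                     Unique (a ∷ b ∷ ps) → Linked _~_ (a ∷ b ∷ ps) →
                     ∃₂ λ l p → l ≢ p × HasOnlyNeighbour l p
    extend-to-leaf k a b ps len unique linked
      with any? (λ w → (a ~? w) ×-dec ¬? (w Fin.≟ b))
    ... | no none = a , b , All.head (AllPairs.head unique) , only
      where
      only : HasOnlyNeighbour a b
      only w a~w with w Fin.≟ b
      ... | yes w≡b = w≡b
      ... | no  w≢b = contradiction (w , a~w , w≢b) none
    ... | yes (w , a~w , w≢b) with DecMembership._∈?_ Fin._≟_ w (a ∷ b ∷ ps)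
    ...   | yes (here w≡a) = contradiction a~w (~-irrefl (sym w≡a))
    ...   | yes (there (here w≡b)) = contradiction w≡b w≢b
    ...   | yes (there (there w∈ps)) with ∈-∃++ w∈ps
    -- A neighbour `w` of `a` further along the path closes the initial segment `a, b, ys, w` into a
    -- cycle.
    ...     | ys , zs , refl = contradiction cycle (acyclic a (b ∷ ys ∷ʳ w))
      where
      cycle : IsCycle G a (b ∷ ys ∷ʳ w)
      cycle = s≤s (≤-trans (m≤n+m 1 (length ys)) (≤-reflexive (sym (List.length-++ ys))))
            , unique-++⁻ˡ (a ∷ b ∷ ys ∷ʳ w) (subst (λ qs → Unique (a ∷ b ∷ qs)) (sym (List.++-assoc ys [ w ] zs)) unique)
            , linked-close (b ∷ ys) linked (~-sym a~w)
    -- The path already has `n` distinct vertices, so prepending the new vertex `w` contradicts the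
    -- pigeonhole principle.
    extend-to-leaf zero a b ps len unique linked | yes (w , _) | no w∉ =
      contradiction (unique⇒length≤ (All.¬Any⇒All¬ _ w∉ ∷ unique))
        (<⇒≱ (s≤s (≤-reflexive (trans (sym len) (+-identityʳ _)))))
    extend-to-leaf (suc k) a b ps len unique linked | yes (w , a~w , _) | no w∉ =
      extend-to-leaf k w a (b ∷ ps) (trans (sym (+-suc _ k)) len)
        (All.¬Any⇒All¬ _ w∉ ∷ unique) (~-sym a~w ∷ linked)

-- The neighbour has the form `punchIn l p`, so that `p` is directly a vertex of the graph with `l`
-- deleted.
acyclic⇒leaf : (G : SimpleGraph (2 + n)) → Acyclic G → ∃₂ λ l p → HasOnlyNeighbour G l (punchIn l p)
acyclic⇒leaf {n} G acyclic = leaf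
  where
  open SimpleGraph G

  leaf≢ : ∃₂ λ l p → l ≢ p × HasOnlyNeighbour G l p
  leaf≢ with any? (zero ~?_)
  -- If `zero` is isolated, any other vertex may serve as `p`; `suc zero` is an arbitrary choice.
  ... | no none = zero , suc zero , (λ ()) , λ w 0~w → contradiction (w , 0~w) none
  -- The starting path `w, zero` uses two of the `2 + n` vertices, which leaves `n` extensions.
  ... | yes (w , 0~w) = extend-to-leaf G acyclic n w zero [] refl
    (((λ w≡0 → ~-irrefl (sym w≡0) 0~w) ∷ []) ∷ [] ∷ []) (~-sym 0~w ∷ [-])

  leaf : ∃₂ λ l p → HasOnlyNeighbour G l (punchIn l p)
  leaf with l , p , l≢p , only ← leaf≢ =
    l , punchOut l≢p , λ w l~w → trans (only w l~w) (sym (punchIn-punchOut l≢p))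

delete : SimpleGraph (suc n) → Fin (suc n) → SimpleGraph n
delete G l = record
  { _~_      = _~_ on punchIn l
  ; ~-sym    = ~-sym
  ; ~-irrefl = λ i≡j → ~-irrefl (cong (punchIn l) i≡j)
  ; _~?_     = λ i j → punchIn l i ~? punchIn l j
  }
  where open SimpleGraph G

delete-acyclic : (G : SimpleGraph (suc n)) → Acyclic G → ∀ l → Acyclic (delete G l)
delete-acyclic G acyclic l v vs (len , unique , linked) =
  acyclic (punchIn l v) (map (punchIn l) vs)
    ( ≤-trans len (≤-reflexive (sym (List.length-map (punchIn l) vs)))
    , Unique.map⁺ (punchIn-injective l _ _) unique
    , subst (λ qs → Linked (SimpleGraph._~_ G) (punchIn l v ∷ qs)) (List.map-++ (punchIn l) vs [ v ])
        (Linked.map⁺ linked))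

-- The path

-- Abstract in the step relation `S` and the order, so that it covers cycles whose first step goes
-- up and, with both relations reversed, those whose first step goes down.
module _ {S _<ᵣ_ : Rel A 0ℓ}
         (S-injective : ∀ {x y z} → S y x → S z x → y ≡ z)
         (S⇒< : ∀ {x y} → S x y → x <ᵣ y)
         (<-transitive : Transitive _<ᵣ_)
         (<-irreflexive : ∀ {x} → ¬ (x <ᵣ x)) where

  private
    S⊎ : Rel A 0ℓ
    S⊎ x y = S x y ⊎ S y x

  -- Without backtracking a chain that starts upwards keeps going upwards.
  no-return : ∀ {a b v} cs → S a b → v <ᵣ a → Unique (a ∷ b ∷ cs) → ¬ Linked S⊎ (b ∷ cs ∷ʳ v)
  no-return []       a→b v<a u (inj₁ b→v ∷ _) = <-irreflexive (<-transitive v<a (<-transitive (S⇒< a→b) (S⇒< b→v)))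
  no-return []       a→b v<a u (inj₂ v→b ∷ _) = <-irreflexive (subst (_<ᵣ _) (S-injective v→b a→b) v<a)
  no-return (c ∷ cs) a→b v<a (_ ∷ u) (inj₁ b→c ∷ ls) = no-return cs b→c (<-transitive v<a (S⇒< a→b)) u ls
  no-return (c ∷ cs) a→b v<a ((_ ∷ a≢c ∷ _) ∷ _) (inj₂ c→b ∷ ls) = a≢c (S-injective a→b c→b)

  -- After the step up from `v` to `a`, a second step up is excluded by `no-return`, and a step down
  -- would lead back to `v`, which is distinct from `b`.
  no-cycle : ∀ {v a b} cs → S v a → Unique (v ∷ a ∷ b ∷ cs) → ¬ Linked S⊎ (a ∷ b ∷ cs ∷ʳ v)
  no-cycle cs v→a (_ ∷ u) (inj₁ a→b ∷ ls) = no-return cs a→b (S⇒< v→a) u ls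
  no-cycle cs v→a ((_ ∷ v≢b ∷ _) ∷ _) (inj₂ b→a ∷ ls) = v≢b (S-injective v→a b→a)

path-acyclic : ∀ n → Acyclic (path n)
path-acyclic n v (a ∷ b ∷ cs) (_ , u , inj₁ v→a ∷ ls) =
  no-cycle {S = λ i j → toℕ j ≡ suc (toℕ i)} {_<ᵣ_ = Fin._<_}
    (λ p q → toℕ-injective (suc-injective (trans (sym p) q)))
    (λ p → ≤-reflexive (sym p)) <-trans (<-irrefl refl) cs v→a u ls
path-acyclic n v (a ∷ b ∷ cs) (_ , u , inj₂ a→v ∷ ls) =
  no-cycle {S = λ i j → toℕ i ≡ suc (toℕ j)} {_<ᵣ_ = flip Fin._<_}
    (λ p q → toℕ-injective (trans p (sym q)))
    (λ p → ≤-reflexive (sym p)) (flip <-trans) (<-irrefl refl) cs a→v u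
    (Linked.map swap ls)
path-acyclic n v (a ∷ []) (s≤s () , _)

path-from-zero : ∀ (i : Fin (suc n)) → Star (SimpleGraph._~_ (path (suc n))) zero i
path-from-zero zero = ε
path-from-zero {suc n} (suc i) =
  inj₁ refl ◅ gmap suc (λ { (inj₁ p) → inj₁ (cong suc p) ; (inj₂ p) → inj₂ (cong suc p) }) (path-from-zero i)

path-connected : ∀ n → Connected (path n)
path-connected (suc n) u v =
  reverse (SimpleGraph.~-sym (path (suc n))) (path-from-zero u) ◅◅ path-from-zero v

path-isTree : ∀ n → IsTree (path n)
path-isTree n = path-connected n , path-acyclic n

-- Colourings of forests

-- With `b = a + x` and `d = c + y` the two sides differ by `x * y`.
rearrangement : ∀ {a b c d} → a ≤ b → c ≤ d → a * d + b * c ≤ a * c + b * d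
rearrangement {a} {b} {c} {d} a≤b c≤d with m≤n⇒∃[o]m+o≡n a≤b | m≤n⇒∃[o]m+o≡n c≤d
... | x , refl | y , refl = ≤-trans (m≤m+n _ (x * y)) (≤-reflexive (identity a x c y))
  where
  identity : ∀ a x c y → a * (c + y) + (a + x) * c + x * y ≡ a * c + (a + x) * (c + y)
  identity = solve-∀

-- Built one edge at a time to match the pruning of leaves; a root with several children is a nested
-- `attach` in the first argument.
data RootedTree : Set where
  single : RootedTree
  -- attach R S joins the roots of R and S and keeps the root of R.
  attach : RootedTree → RootedTree → RootedTree

edges : RootedTree → ℕ
edges single       = 0
edges (attach R S) = suc (edges S) + edges R

-- Counting colourings with the adjacency operator of the target

module _ (H : Graph) where
  open Graph H

  private
    Σᵥ : (V → ℕ) → ℕ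
    Σᵥ = ∑ vertices

    one : V → ℕ
    one _ = 1

    ⟪_,_⟫ : (V → ℕ) → (V → ℕ) → ℕ
    ⟪ f , g ⟫ = Σᵥ λ v → f v * g v

  -- The adjacency matrix of `H` applied to the vector `φ`. Its powers count walks: `adj^ k one v`
  -- is the number of walks of length `k` starting at `v`.
  adj : (V → ℕ) → V → ℕ
  adj φ v = Σᵥ λ w → 𝟙 (v ~? w) * φ w

  adj^ : ℕ → (V → ℕ) → V → ℕ
  adj^ zero    φ = φ
  adj^ (suc k) φ = adj (adj^ k φ)

  adj-mono : ∀ {φ ψ} → (∀ v → φ v ≤ ψ v) → ∀ v → adj φ v ≤ adj ψ v
  adj-mono φ≤ψ v = ∑-mono vertices λ w → *-monoʳ-≤ (𝟙 (v ~? w)) (φ≤ψ w)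

  adj-cong : ∀ {φ ψ} → (∀ v → φ v ≡ ψ v) → ∀ v → adj φ v ≡ adj ψ v
  adj-cong φ≗ψ v = ∑-cong vertices λ w → cong (𝟙 (v ~? w) *_) (φ≗ψ w)

  adj-linear : ∀ a b φ ψ v → adj (λ w → a * φ w + b * ψ w) v ≡ a * adj φ v + b * adj ψ v
  adj-linear a b φ ψ v = begin
    Σᵥ (λ w → 𝟙 (v ~? w) * (a * φ w + b * ψ w))
      ≡⟨ ∑-cong vertices (λ w → rearrange (𝟙 (v ~? w)) a (φ w) b (ψ w)) ⟩
    Σᵥ (λ w → a * (𝟙 (v ~? w) * φ w) + b * (𝟙 (v ~? w) * ψ w))
      ≡⟨ ∑-+ vertices _ _ ⟩
    Σᵥ (λ w → a * (𝟙 (v ~? w) * φ w)) + Σᵥ (λ w → b * (𝟙 (v ~? w) * ψ w))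
      ≡⟨ cong₂ _+_ (∑-*ˡ vertices a _) (∑-*ˡ vertices b _) ⟩
    a * adj φ v + b * adj ψ v ∎
    where
    open ≡-Reasoning
    rearrange : ∀ i a x b y → i * (a * x + b * y) ≡ a * (i * x) + b * (i * y)
    rearrange = solve-∀

  𝟙-~-sym : ∀ v w → 𝟙 (v ~? w) ≡ 𝟙 (w ~? v)
  𝟙-~-sym v w = ≤-antisym (𝟙-mono (v ~? w) (w ~? v) ~-sym) (𝟙-mono (w ~? v) (v ~? w) ~-sym)

  -- The adjacency matrix is symmetric. This moves an edge from one side of a pairing to the other.
  adj-selfAdjoint : ∀ f g → ⟪ f , adj g ⟫ ≡ ⟪ adj f , g ⟫
  adj-selfAdjoint f g = begin
    Σᵥ (λ v → f v * adj g v)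
      ≡⟨ ∑-cong vertices (λ v → ∑-*ˡ vertices (f v) _) ⟨
    Σᵥ (λ v → Σᵥ (λ w → f v * (𝟙 (v ~? w) * g w)))
      ≡⟨ ∑-swap vertices vertices (λ v w → f v * (𝟙 (v ~? w) * g w)) ⟩
    Σᵥ (λ w → Σᵥ (λ v → f v * (𝟙 (v ~? w) * g w)))
      ≡⟨ ∑-cong vertices (λ w → ∑-cong vertices (λ v → move v w)) ⟩
    Σᵥ (λ w → Σᵥ (λ v → g w * (𝟙 (w ~? v) * f v)))
      ≡⟨ ∑-cong vertices (λ w → trans (∑-*ˡ vertices (g w) _) (*-comm (g w) _)) ⟩
    Σᵥ (λ w → adj f w * g w) ∎
    where
    open ≡-Reasoning
    reverse-* : ∀ x i y → x * (i * y) ≡ y * (i * x)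
    reverse-* = solve-∀
    move : ∀ v w → f v * (𝟙 (v ~? w) * g w) ≡ g w * (𝟙 (w ~? v) * f v)
    move v w = trans (cong (λ i → f v * (i * g w)) (𝟙-~-sym v w)) (reverse-* (f v) (𝟙 (w ~? v)) (g w))

  adj^-+ : ∀ j k φ → adj^ (j + k) φ ≡ adj^ j (adj^ k φ)
  adj^-+ zero    k φ = refl
  adj^-+ (suc j) k φ = cong adj (adj^-+ j k φ)

  adj^-suc : ∀ k φ → adj^ k (adj φ) ≡ adj^ (suc k) φ
  adj^-suc zero    φ = refl
  adj^-suc (suc k) φ = cong adj (adj^-suc k φ)

  adj^-mono : ∀ k {φ ψ} → (∀ v → φ v ≤ ψ v) → ∀ v → adj^ k φ v ≤ adj^ k ψ v
  adj^-mono zero    φ≤ψ = φ≤ψ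
  adj^-mono (suc k) φ≤ψ = adj-mono (adj^-mono k φ≤ψ)

  adj^-linear : ∀ k a b φ ψ v → adj^ k (λ w → a * φ w + b * ψ w) v ≡ a * adj^ k φ v + b * adj^ k ψ v
  adj^-linear zero    a b φ ψ v = refl
  adj^-linear (suc k) a b φ ψ v =
    trans (adj-cong (adj^-linear k a b φ ψ) v) (adj-linear a b (adj^ k φ) (adj^ k ψ) v)

  adj^-selfAdjoint : ∀ k f g → ⟪ f , adj^ k g ⟫ ≡ ⟪ adj^ k f , g ⟫
  adj^-selfAdjoint zero    f g = refl
  adj^-selfAdjoint (suc k) f g = begin
    ⟪ f , adj (adj^ k g) ⟫ ≡⟨ adj-selfAdjoint f (adj^ k g) ⟩
    ⟪ adj f , adj^ k g ⟫   ≡⟨ adj^-selfAdjoint k (adj f) g ⟩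
    ⟪ adj^ k (adj f) , g ⟫ ≡⟨ cong (λ φ → ⟪ φ , g ⟫) (adj^-suc k f) ⟩
    ⟪ adj^ (suc k) f , g ⟫ ∎
    where open ≡-Reasoning

  -- The number of colourings of the tree whose root has colour `v`.
  rooted : RootedTree → V → ℕ
  rooted single       v = 1
  rooted (attach R S) v = rooted R v * adj (rooted S) v

  -- Counts the colourings of G with a copy of the tree τ i hung at each vertex i.
  Z : SimpleGraph n → Vector RootedTree n → ℕ
  Z G τ = ∑ (vectors vertices _) λ f →
    𝟙 (isColoring? G H (lookup f)) * ∏ λ i → rooted (τ i) (lookup f i)

  hom≡∑ : (G : SimpleGraph n) → hom G H ≡ ∑ (vectors vertices n) (λ f → 𝟙 (isColoring? G H (lookup f)))
  hom≡∑ G = length-filter (λ f → isColoring? G H (lookup f)) (vectors vertices _)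

  Z-single : (G : SimpleGraph n) → Z G (const single) ≡ hom G H
  Z-single {n} G = sym (trans (hom≡∑ G)
    (∑-cong (vectors vertices n) λ f →
      sym (trans (cong (𝟙 (isColoring? G H (lookup f)) *_) (Product.sum-replicate-zero n)) (*-identityʳ (𝟙 (isColoring? G H (lookup f)))))))

  Z-one-vertex : (G : SimpleGraph 1) (τ : Vector RootedTree 1) → Σᵥ (rooted (τ zero)) ≤ Z G τ
  Z-one-vertex G τ = ≤-trans
    (∑-mono vertices λ x → ≤-reflexive (sym (begin
      𝟙 (isColoring? G H (lookup (x ∷ []))) * (rooted (τ zero) x * 1) + 0
        ≡⟨ cong (λ i → i * (rooted (τ zero) x * 1) + 0) (𝟙-yes (isColoring? G H (lookup (x ∷ []))) (colouring x)) ⟩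
      1 * (rooted (τ zero) x * 1) + 0
        ≡⟨ units (rooted (τ zero) x) ⟩
      rooted (τ zero) x ∎)))
    (≤-reflexive (sym (∑-vectors-insertAt {n = 0} vertices zero
      (λ f → 𝟙 (isColoring? G H (lookup f)) * ∏ λ i → rooted (τ i) (lookup f i)))))
    where
    open ≡-Reasoning
    units : ∀ x → 1 * (x * 1) + 0 ≡ x
    units = solve-∀
    colouring : ∀ x → IsColoring G H (lookup (x ∷ []))
    colouring x zero zero 0~0 = contradiction 0~0 (SimpleGraph.~-irrefl G refl)

  -- An edge of `G` either avoids `l` or joins `l` to its only possible neighbour, so the single new
  -- constraint is the one between the colours of `p` and `l`.
  insertAt-colouring : (G : SimpleGraph (suc n)) {l : Fin (suc n)} {p : Fin n} → HasOnlyNeighbour G l (punchIn l p) →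
                       ∀ g x → IsColoring (delete G l) H (lookup g) × lookup g p ~ x →
                       IsColoring G H (lookup (insertAt g l x))
  insertAt-colouring {n} G {l} {p} only g x (colouring , gp~x) u v u~v = go (split u) (split v) u~v
    where
    module G = SimpleGraph G

    split : ∀ u → (u ≡ l) ⊎ (Σ[ i ∈ Fin n ] punchIn l i ≡ u)
    split u with l Fin.≟ u
    ... | yes l≡u = inj₁ (sym l≡u)
    ... | no  l≢u = inj₂ (punchOut l≢u , punchIn-punchOut l≢u)

    towards-leaf : ∀ i → l G.~ punchIn l i → lookup (insertAt g l x) (punchIn l i) ~ lookup (insertAt g l x) l
    towards-leaf i l~i with refl ← punchIn-injective l i p (only _ l~i) =
      subst₂ _~_ (sym (insertAt-punchIn g l x i)) (sym (insertAt-lookup g l x)) gp~x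

    go : ∀ {u v} → (u ≡ l) ⊎ (Σ[ i ∈ Fin n ] punchIn l i ≡ u) → (v ≡ l) ⊎ (Σ[ i ∈ Fin n ] punchIn l i ≡ v) →
         u G.~ v → lookup (insertAt g l x) u ~ lookup (insertAt g l x) v
    go (inj₁ refl)       (inj₁ refl)       l~l = contradiction l~l (G.~-irrefl refl)
    go (inj₁ refl)       (inj₂ (j , refl)) l~j = ~-sym (towards-leaf j l~j)
    go (inj₂ (i , refl)) (inj₁ refl)       i~l = towards-leaf i (G.~-sym i~l)
    go (inj₂ (i , refl)) (inj₂ (j , refl)) i~j =
      subst₂ _~_ (sym (insertAt-punchIn g l x i)) (sym (insertAt-punchIn g l x j)) (colouring i j i~j)

  -- The leaf `l`, with the tree hung at it, becomes a new branch of the tree hung at `p`.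
  graft : Vector RootedTree (suc n) → Fin (suc n) → Fin n → Vector RootedTree n
  graft τ l p = updateAt (removeAt τ l) p (λ R → attach R (τ l))

  -- Only an inequality, because the leaf l may be isolated.
  Z-graft : (G : SimpleGraph (suc n)) (τ : Vector RootedTree (suc n)) {l : Fin (suc n)} {p : Fin n} →
            HasOnlyNeighbour G l (punchIn l p) → Z (delete G l) (graft τ l p) ≤ Z G τ
  Z-graft {n} G τ {l} {p} only = begin
    Z (delete G l) (graft τ l p)
      -- The new factor `adj (rooted (τ l))` at `p` unfolds into a sum over the colours `x` of the
      -- removed leaf.
      ≡⟨ ∑-cong (vectors vertices n) expand ⟩
    ∑ (vectors vertices n) (λ g → Σᵥ (λ x → term g x))
      ≡⟨ ∑-swap (vectors vertices n) vertices term ⟩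
    Σᵥ (λ x → ∑ (vectors vertices n) (λ g → term g x))
      ≤⟨ ∑-mono vertices (λ x → ∑-mono (vectors vertices n) λ g → compare g x) ⟩
    Σᵥ (λ x → ∑ (vectors vertices n) (λ g → F (insertAt g l x)))
      ≡⟨ ∑-vectors-insertAt vertices l F ⟨
    Z G τ ∎
    where
    open ≤-Reasoning

    F : Vec V (suc n) → ℕ
    F f = 𝟙 (isColoring? G H (lookup f)) * ∏ λ i → rooted (τ i) (lookup f i)

    rest : Vec V n → ℕ
    rest g = ∏ λ i → rooted (τ (punchIn l i)) (lookup g i)

    col? : ∀ g → Dec (IsColoring (delete G l) H (lookup g))
    col? g = isColoring? (delete G l) H (lookup g)

    term : Vec V n → V → ℕ
    term g x = (𝟙 (col? g) * rest g) * (𝟙 (lookup g p ~? x) * rooted (τ l) x)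

    expand : ∀ g → 𝟙 (col? g) * ∏ (λ i → rooted (graft τ l p i) (lookup g i)) ≡ Σᵥ (term g)
    expand g = trans
      (cong (𝟙 (col? g) *_)
        (sum-updateAt *-1-commutativeMonoid (λ i R → rooted R (lookup g i)) (removeAt τ l) p _ refl))
      (trans (sym (*-assoc (𝟙 (col? g)) (rest g) _)) (sym (∑-*ˡ vertices (𝟙 (col? g) * rest g) _)))

    weights : ∀ g x → ∏ (λ i → rooted (τ i) (lookup (insertAt g l x) i)) ≡ rooted (τ l) x * rest g
    weights g x = trans (Product.sum-remove {i = l} (λ i → rooted (τ i) (lookup (insertAt g l x) i)))
      (cong₂ _*_ (cong (rooted (τ l)) (insertAt-lookup g l x))
                 (Product.sum-cong-≗ λ i → cong (rooted (τ (punchIn l i))) (insertAt-punchIn g l x i)))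

    regroup : ∀ c r i y → (c * r) * (i * y) ≡ (c * i) * (y * r)
    regroup = solve-∀

    compare : ∀ g x → term g x ≤ F (insertAt g l x)
    compare g x = begin
      term g x
        ≡⟨ regroup (𝟙 (col? g)) (rest g) _ _ ⟩
      𝟙 (col? g) * 𝟙 (lookup g p ~? x) * (rooted (τ l) x * rest g)
        ≡⟨ cong₂ _*_ (𝟙-× (col? g) (lookup g p ~? x)) (weights g x) ⟨
      𝟙 (col? g ×-dec (lookup g p ~? x)) * ∏ (λ i → rooted (τ i) (lookup (insertAt g l x) i))
        ≤⟨ *-monoˡ-≤ _ (𝟙-mono (col? g ×-dec (lookup g p ~? x)) (isColoring? G H (lookup (insertAt g l x)))
                         (insertAt-colouring G only g x)) ⟩
      F (insertAt g l x) ∎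

  -- Transfer-matrix argument: summing over the colour of the first vertex turns its weight `φ` into
  -- the weight `adj φ` at the next vertex.
  path-weighted : ∀ n φ → ∑ (vectors vertices (suc n))
                            (λ f → 𝟙 (isColoring? (path (suc n)) H (lookup f)) * φ (lookup f zero))
                          ≤ Σᵥ (adj^ n φ)
  path-weighted zero φ = begin
    ∑ (vectors vertices 1) F          ≡⟨ ∑-vectors-insertAt {n = 0} vertices zero F ⟩
    Σᵥ (λ x → F (x ∷ []) + 0)         ≤⟨ ∑-mono vertices (λ x → ≤-trans (≤-reflexive (+-identityʳ _))
                                           (≤-trans (*-monoˡ-≤ (φ x) (𝟙≤1 (isColoring? (path 1) H (lookup (x ∷ [])))))
                                             (≤-reflexive (*-identityˡ (φ x))))) ⟩
    Σᵥ φ                              ∎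
    where
    open ≤-Reasoning
    F : Vec V 1 → ℕ
    F f = 𝟙 (isColoring? (path 1) H (lookup f)) * φ (lookup f zero)
  path-weighted (suc n) φ = begin
    ∑ (vectors vertices (2 + n)) F
      ≡⟨ ∑-vectors-insertAt vertices zero F ⟩
    Σᵥ (λ x → ∑ (vectors vertices (suc n)) (λ g → F (x ∷ g)))
      ≤⟨ ∑-mono vertices (λ x → ∑-mono (vectors vertices (suc n)) (compare x)) ⟩
    Σᵥ (λ x → ∑ (vectors vertices (suc n)) (term x))
      ≡⟨ ∑-swap vertices (vectors vertices (suc n)) term ⟩
    ∑ (vectors vertices (suc n)) (λ g → Σᵥ (λ x → term x g))
      ≡⟨ ∑-cong (vectors vertices (suc n)) (λ g → ∑-*ˡ vertices (𝟙 (col? g)) _) ⟩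
    ∑ (vectors vertices (suc n)) (λ g → 𝟙 (col? g) * adj φ (lookup g zero))
      ≤⟨ path-weighted n (adj φ) ⟩
    Σᵥ (adj^ n (adj φ))
      ≡⟨ cong Σᵥ (adj^-suc n φ) ⟩
    Σᵥ (adj^ (suc n) φ) ∎
    where
    open ≤-Reasoning
    F : Vec V (2 + n) → ℕ
    F f = 𝟙 (isColoring? (path (2 + n)) H (lookup f)) * φ (lookup f zero)

    col? : ∀ (g : Vec V (suc n)) → Dec (IsColoring (path (suc n)) H (lookup g))
    col? g = isColoring? (path (suc n)) H (lookup g)

    term : V → Vec V (suc n) → ℕ
    term x g = 𝟙 (col? g) * (𝟙 (lookup g zero ~? x) * φ x)

    restrict : ∀ x g → IsColoring (path (2 + n)) H (lookup (x ∷ g)) →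
               IsColoring (path (suc n)) H (lookup g) × lookup g zero ~ x
    restrict x g colouring =
      (λ { u v (inj₁ p) → colouring (suc u) (suc v) (inj₁ (cong suc p))
         ; u v (inj₂ p) → colouring (suc u) (suc v) (inj₂ (cong suc p)) })
      , colouring (suc zero) zero (inj₂ refl)

    compare : ∀ x g → F (x ∷ g) ≤ term x g
    compare x g = ≤-trans
      (*-monoˡ-≤ (φ x) (𝟙-mono (isColoring? (path (2 + n)) H (lookup (x ∷ g))) (col? g ×-dec (lookup g zero ~? x))
                         (restrict x g)))
      (≤-reflexive (trans (cong (_* φ x) (𝟙-× (col? g) (lookup g zero ~? x))) (*-assoc (𝟙 (col? g)) _ _)))

  hom-path≤ : ∀ n → hom (path (suc n)) H ≤ Σᵥ (adj^ n one)
  hom-path≤ n = ≤-trans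
    (≤-reflexive (trans (hom≡∑ (path (suc n)))
      (∑-cong (vectors vertices (suc n)) λ f → sym (*-identityʳ (𝟙 (isColoring? (path (suc n)) H (lookup f)))))))
    (path-weighted n one)

  -- Straightening trees under monotone weights

  module _ {_≼_ : Rel V 0ℓ} (≼-total : Total _≼_) where

    Monotone : (V → ℕ) → Set
    Monotone φ = ∀ {u v} → u ≼ v → φ u ≤ φ v

    -- Sum (A u − A v)(B u − B v) ≥ 0 over all walks of length k, with endpoints u and v.
    move-to-end : ∀ k {A B} → Monotone A → Monotone B →
                  ⟪ B , adj^ k A ⟫ ≤ ⟪ (λ v → A v * B v) , adj^ k one ⟫
    move-to-end k {A} {B} A↗ B↗ = *-cancelˡ-≤ 2 (begin
      2 * ⟪ B , adj^ k A ⟫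
        ≡⟨ double ⟪ B , adj^ k A ⟫ ⟩
      ⟪ B , adj^ k A ⟫ + ⟪ B , adj^ k A ⟫
        -- Self-adjointness exchanges the two ends of the walk, so both cross terms of the product
        -- of differences appear; hence the factor 2.
        ≡⟨ cong (⟪ B , adj^ k A ⟫ +_) (trans (adj^-selfAdjoint k B A) (∑-cong vertices λ v → *-comm (adj^ k B v) (A v))) ⟩
      ⟪ B , adj^ k A ⟫ + ⟪ A , adj^ k B ⟫
        ≡⟨ ∑-+ vertices _ _ ⟨
      Σᵥ (λ u → B u * adj^ k A u + A u * adj^ k B u)
        ≤⟨ ∑-mono vertices pointwise ⟩
      Σᵥ (λ u → A u * B u * adj^ k one u + 1 * adj^ k AB u)
        ≡⟨ ∑-+ vertices _ _ ⟩
      ⟪ AB , adj^ k one ⟫ + ⟪ one , adj^ k AB ⟫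
        ≡⟨ cong (⟪ AB , adj^ k one ⟫ +_) (trans (adj^-selfAdjoint k one AB) (∑-cong vertices λ v → *-comm (adj^ k one v) (AB v))) ⟩
      ⟪ AB , adj^ k one ⟫ + ⟪ AB , adj^ k one ⟫
        ≡⟨ double ⟪ AB , adj^ k one ⟫ ⟨
      2 * ⟪ AB , adj^ k one ⟫ ∎)
      where
      open ≤-Reasoning
      AB : V → ℕ
      AB v = A v * B v

      double : ∀ x → 2 * x ≡ x + x
      double = solve-∀

      swapped : ∀ a b c d → b * c + a * d ≡ a * d + c * b
      swapped = solve-∀

      units : ∀ x y → x + y ≡ x * 1 + 1 * y
      units = solve-∀

      -- Totality orders `u` and `v` one way or the other, and `A` and `B` agree with that order.
      -- The factors 1 give the bound the shape that `adj^-linear` expects.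
      exchange : ∀ u v → B u * A v + A u * B v ≤ AB u * 1 + 1 * AB v
      exchange u v = ≤-trans (lemma (≼-total u v)) (≤-reflexive (units (AB u) (AB v)))
        where
        lemma : u ≼ v ⊎ v ≼ u → B u * A v + A u * B v ≤ AB u + AB v
        lemma (inj₁ u≼v) = ≤-trans (≤-reflexive (swapped (A u) (B u) (A v) (B v)))
          (rearrangement (A↗ u≼v) (B↗ u≼v))
        lemma (inj₂ v≼u) = ≤-trans (≤-reflexive (cong (_+ A u * B v) (*-comm (B u) (A v))))
          (≤-trans (rearrangement (A↗ v≼u) (B↗ v≼u)) (≤-reflexive (+-comm (AB v) _)))

      pointwise : ∀ u → B u * adj^ k A u + A u * adj^ k B u ≤ A u * B u * adj^ k one u + 1 * adj^ k AB u
      pointwise u = begin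
        B u * adj^ k A u + A u * adj^ k B u
          ≡⟨ adj^-linear k (B u) (A u) A B u ⟨
        adj^ k (λ v → B u * A v + A u * B v) u
          ≤⟨ adj^-mono k (exchange u) u ⟩
        adj^ k (λ v → AB u * 1 + 1 * AB v) u
          ≡⟨ adj^-linear k (AB u) 1 one AB u ⟩
        AB u * adj^ k one u + 1 * adj^ k AB u ∎

    module _ (adj-monotone : ∀ {φ} → Monotone φ → Monotone (adj φ)) where

      *-monotone : ∀ {φ ψ} → Monotone φ → Monotone ψ → Monotone (λ v → φ v * ψ v)
      *-monotone φ↗ ψ↗ u≼v = *-mono-≤ (φ↗ u≼v) (ψ↗ u≼v)

      adj^-monotone : ∀ k {φ} → Monotone φ → Monotone (adj^ k φ)
      adj^-monotone zero    φ↗ = φ↗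
      adj^-monotone (suc k) φ↗ = adj-monotone (adj^-monotone k φ↗)

      adj^-one-monotone : ∀ k → Monotone (adj^ k one)
      adj^-one-monotone k = adj^-monotone k λ _ → ≤-refl

      rooted-monotone : ∀ R → Monotone (rooted R)
      rooted-monotone single       _ = ≤-refl
      rooted-monotone (attach R S) = *-monotone (rooted-monotone R) (adj-monotone (rooted-monotone S))

      -- Straighten S, then R, then move the weight B from the middle of the path to its end.
      path-minimal : ∀ R {B} → Monotone B → ⟪ B , adj^ (edges R) one ⟫ ≤ ⟪ B , rooted R ⟫
      path-minimal single           B↗ = ≤-refl
      path-minimal (attach R S) {B} B↗ = begin
        ⟪ B , adj^ (k + edges R) one ⟫
          ≡⟨ cong (λ φ → ⟪ B , φ ⟫) (adj^-+ k (edges R) one) ⟩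
        ⟪ B , adj^ k (adj^ (edges R) one) ⟫
          -- Seen from the path: it is cut `k` edges away from its end weighted by `B`, and `B`
          -- moves to the cut.
          ≤⟨ move-to-end k (adj^-one-monotone (edges R)) B↗ ⟩
        ⟪ (λ v → adj^ (edges R) one v * B v) , adj^ k one ⟫
          ≡⟨ ∑-cong vertices (λ v → rotate (adj^ (edges R) one v) (B v) (adj^ k one v)) ⟩
        ⟪ (λ v → B v * adj^ k one v) , adj^ (edges R) one ⟫
          -- Induction on `R`, with the path that stands for `S` absorbed into the weight at the
          -- root.
          ≤⟨ path-minimal R (*-monotone B↗ (adj^-one-monotone k)) ⟩
        ⟪ (λ v → B v * adj^ k one v) , rooted R ⟫
          ≡⟨ ∑-cong vertices (λ v → exchange (B v) (adj^ k one v) (rooted R v)) ⟩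
        ⟪ BR , adj (adj^ (edges S) one) ⟫
          ≡⟨ adj-selfAdjoint BR (adj^ (edges S) one) ⟩
        ⟪ adj BR , adj^ (edges S) one ⟫
          -- Induction on `S`: everything outside `S`, seen through the joining edge, is the
          -- monotone weight `adj BR` at its root.
          ≤⟨ path-minimal S (adj-monotone (*-monotone B↗ (rooted-monotone R))) ⟩
        ⟪ adj BR , rooted S ⟫
          ≡⟨ adj-selfAdjoint BR (rooted S) ⟨
        ⟪ BR , adj (rooted S) ⟫
          ≡⟨ ∑-cong vertices (λ v → *-assoc (B v) (rooted R v) (adj (rooted S) v)) ⟩
        ⟪ B , rooted (attach R S) ⟫ ∎
        where
        open ≤-Reasoning
        k : ℕ
        k = suc (edges S)

        BR : V → ℕ
        BR v = B v * rooted R v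

        rotate : ∀ a b c → a * b * c ≡ b * c * a
        rotate = solve-∀

        exchange : ∀ a b c → a * b * c ≡ a * c * b
        exchange = solve-∀

      -- Induction on the number of vertices. Pruning a leaf turns one edge of `G` into an edge of a
      -- hung tree, so the exponent is unchanged; on one vertex `path-minimal` applies.
      Z-lower-bound : ∀ n (G : SimpleGraph (suc n)) → Acyclic G → (τ : Vector RootedTree (suc n)) →
                      Σᵥ (adj^ (n + sum (edges ∘ τ)) one) ≤ Z G τ
      Z-lower-bound zero G acyclic τ = begin
        Σᵥ (adj^ (edges (τ zero) + 0) one)
          ≡⟨ cong (λ k → Σᵥ (adj^ k one)) (+-identityʳ (edges (τ zero))) ⟩
        Σᵥ (adj^ (edges (τ zero)) one)
          ≡⟨ ∑-cong vertices (λ v → *-identityˡ (adj^ (edges (τ zero)) one v)) ⟨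
        ⟪ one , adj^ (edges (τ zero)) one ⟫
          ≤⟨ path-minimal (τ zero) {one} (λ _ → ≤-refl) ⟩
        ⟪ one , rooted (τ zero) ⟫
          ≡⟨ ∑-cong vertices (λ v → *-identityˡ (rooted (τ zero) v)) ⟩
        Σᵥ (rooted (τ zero))
          ≤⟨ Z-one-vertex G τ ⟩
        Z G τ ∎
        where open ≤-Reasoning
      Z-lower-bound (suc n) G acyclic τ with acyclic⇒leaf G acyclic
      ... | l , p , only = begin
        Σᵥ (adj^ (suc n + sum (edges ∘ τ)) one)
          ≡⟨ cong (λ k → Σᵥ (adj^ k one)) edge-count ⟩
        Σᵥ (adj^ (n + sum (edges ∘ graft τ l p)) one)
          ≤⟨ Z-lower-bound n (delete G l) (delete-acyclic G acyclic l) (graft τ l p) ⟩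
        Z (delete G l) (graft τ l p)
          ≤⟨ Z-graft G τ only ⟩
        Z G τ ∎
        where
        open ≤-Reasoning
        shift : ∀ n e s → suc n + (e + s) ≡ n + (s + suc e)
        shift = solve-∀

        edge-count : suc n + sum (edges ∘ τ) ≡ n + sum (edges ∘ graft τ l p)
        edge-count = trans (cong (suc n +_) (sum-remove {i = l} (edges ∘ τ)))
          (trans (shift n (edges (τ l)) _)
            (cong (n +_) (sym (sum-updateAt +-0-commutativeMonoid (λ _ → edges) (removeAt τ l) p _
              (+-comm (suc (edges (τ l))) _)))))

      -- Pruning starts with a single vertex hung everywhere, hence with no hung edges, and the
      -- exponent is `n`, the length of the path on `suc n` vertices.
      monotone⇒hoffmanLondon : HoffmanLondon H
      monotone⇒hoffmanLondon (suc n) _ =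
        (path (suc n) , path-isTree (suc n) , refl) , λ { _ (T , (_ , acyclic) , refl) → begin
          hom (path (suc n)) H
            ≤⟨ hom-path≤ n ⟩
          Σᵥ (adj^ n one)
            ≡⟨ cong (λ k → Σᵥ (adj^ k one)) (sym (trans (cong (n +_) (sum-replicate-zero (suc n))) (+-identityʳ n))) ⟩
          Σᵥ (adj^ (n + sum {suc n} (const 0)) one)
            ≤⟨ Z-lower-bound n T acyclic (const single) ⟩
          Z T (const single)
            ≡⟨ Z-single T ⟩
          hom T H ∎ }
        where open ≤-Reasoning

-- Blow-ups of the looped star

∑-blowUp : ∀ H (n : Graph.V H → ℕ) f →
           ∑ (Graph.vertices (blowUp H n)) f ≡ ∑ (Graph.vertices H) λ v → sum λ x → f (v , x)
∑-blowUp H n f = trans (∑-concatMap _ vertices f)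
  (∑-cong vertices λ v → trans (∑-map (v ,_) (allFin (n v)) f) (∑-tabulate id (f ∘ (v ,_))))
  where open Graph H

module _ (t : ℕ) (n : Fin (suc t) → ℕ) where

  private
    module S = Graph (loopedStar t)
    module B = Graph (blowUp (loopedStar t) n)

  -- Compares parts only, since vertices of one part have the same neighbourhood. Leaf parts of
  -- equal size lie below each other, and a monotone function takes one value on both.
  data _≼_ : Rel (Fin (suc t)) 0ℓ where
    below-centre : ∀ {i} → i ≼ zero
    leaves       : ∀ {i j} → n (suc i) ≤ n (suc j) → suc i ≼ suc j

  ≼-total : Total (_≼_ on proj₁ {B = λ i → Fin (n i)})
  ≼-total (i , _)     (zero , _)  = inj₁ below-centre
  ≼-total (zero , _)  (suc j , _) = inj₂ below-centre
  ≼-total (suc i , _) (suc j , _) with ≤-total (n (suc i)) (n (suc j))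
  ... | inj₁ i≤j = inj₁ (leaves i≤j)
  ... | inj₂ j≤i = inj₂ (leaves j≤i)

  centre-adjacent : ∀ i → zero S.~ i
  centre-adjacent zero    = loop
  centre-adjacent (suc i) = outward

  weighted-yes : ∀ {m} {P : Set} (d : Dec P) → P → (f : Vector ℕ m) → sum (λ x → 𝟙 d * f x) ≡ sum f
  weighted-yes d p f = sum-cong-≗ λ x → trans (cong (_* f x) (𝟙-yes d p)) (*-identityˡ (f x))

  weighted-no : ∀ {m} {P : Set} (d : Dec P) → ¬ P → (f : Vector ℕ m) → sum (λ x → 𝟙 d * f x) ≡ 0
  weighted-no {m} d ¬p f = trans (sum-cong-≗ λ x → cong (_* f x) (𝟙-no d ¬p)) (sum-replicate-zero m)

  -- Among the parts, a leaf part is adjacent only to the centre and, through its loop, to itself.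
  adj-leaf : ∀ φ i x → adj (blowUp (loopedStar t) n) φ (suc i , x)
                       ≡ sum (λ y → φ (zero , y)) + sum (λ y → φ (suc i , y))
  adj-leaf φ i x = begin
    adj (blowUp (loopedStar t) n) φ (suc i , x)
      ≡⟨ ∑-blowUp (loopedStar t) n (λ w → 𝟙 ((suc i , x) B.~? w) * φ w) ⟩
    ∑ (allFin (suc t)) part
      ≡⟨ ∑-tabulate id part ⟩
    part zero + sum (part ∘ suc)
      ≡⟨ cong₂ _+_ (weighted-yes (suc i S.~? zero) inward (λ y → φ (zero , y)))
                   (sum-single (part ∘ suc) i λ k i≢k →
                     weighted-no (suc i S.~? suc k) (λ { loop → i≢k refl }) (λ y → φ (suc k , y))) ⟩
    sum (λ y → φ (zero , y)) + part (suc i)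
      ≡⟨ cong (sum (λ y → φ (zero , y)) +_) (weighted-yes (suc i S.~? suc i) loop (λ y → φ (suc i , y))) ⟩
    sum (λ y → φ (zero , y)) + sum (λ y → φ (suc i , y)) ∎
    where
    open ≡-Reasoning
    part : Fin (suc t) → ℕ
    part k = sum λ y → 𝟙 (suc i S.~? k) * φ (k , y)

  -- The centre is adjacent to everything, so its neighbourhood contains every other. Two leaf parts
  -- share the centre as neighbours, and the larger one contributes at least as many terms of its
  -- own, each at least as large because `φ` is monotone.
  adj-monotone : ∀ {φ} → Monotone (blowUp (loopedStar t) n) ≼-total φ →
                 Monotone (blowUp (loopedStar t) n) ≼-total (adj (blowUp (loopedStar t) n) φ)
  adj-monotone {φ} φ↗ {u} {v} below-centre = ∑-mono B.vertices λ w →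
    *-monoˡ-≤ (φ w) (𝟙-mono (u B.~? w) (v B.~? w) λ _ → centre-adjacent (proj₁ w))
  adj-monotone {φ} φ↗ {suc i , x} {suc j , y} (leaves i≤j) = begin
    adj (blowUp (loopedStar t) n) φ (suc i , x)
      ≡⟨ adj-leaf φ i x ⟩
    sum (λ y → φ (zero , y)) + sum (λ y → φ (suc i , y))
      ≤⟨ +-monoʳ-≤ _ (sum-mono-size i≤j λ _ _ → φ↗ (leaves i≤j)) ⟩
    sum (λ y → φ (zero , y)) + sum (λ y → φ (suc j , y))
      ≡⟨ adj-leaf φ j y ⟨
    adj (blowUp (loopedStar t) n) φ (suc j , y) ∎
    where open ≤-Reasoning

corollary4p14 : ∀ (t : ℕ) → t ≥ 1 → (n : Fin (suc t) → ℕ) → (∀ i → n i ≥ 1) → HoffmanLondon (blowUp (loopedStar t) n)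
corollary4p14 t _ n _ = monotone⇒hoffmanLondon (blowUp (loopedStar t) n) (≼-total t n) (adj-monotone t n)
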